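{- Let $\Psi$ be a $\mathsf{Max\text{ - }2OR}$ instance with $m_1$ 1-clauses and $m_2$ 2-clauses. Then (1) $\mathrm{val}_\Psi\ge\dfrac{m_1+m_2+\mathrm{bias}(\Psi)}{2}$; (2) if $m_2>0$ and $\mathrm{bias}(\Psi)\le m_2$, then $$\mathrm{val}_\Psi\ \ge\ \frac{m_1}{2}+\frac{3m_2}{4}+\frac{\mathrm{bias}(\Psi)^2}{4m_2}.$$
   Context: A $\mathsf{Max\text{ - }2OR}$ instance $\Psi$ consists of Boolean variables $x_1,\dots,x_n$ and a list of clauses, each being either a 1-clause (a single literal $x_i$ or $\neg x_i$) or a 2-clause (a disjunction of two literals of two distinct variables); clauses with two identical literals are regarded as 1-clauses, and there are no tautological clauses. $\mathrm{val}_\Psi$ is the maximum over all assignments of the number of satisfied clauses. For $r\in\{1,2\}$, $\mathrm{pos}^{(r)}_i(\Psi)$ and $\mathrm{neg}^{(r)}_i(\Psi)$ denote the numbers of $r$-clauses containing the literal $x_i$, respectively $\neg x_i$. The bias is $$\mathrm{bias}(\Psi)=\frac12\sum_{i=1}^n\left|2\,\mathrm{pos}^{(1)}_i(\Psi)+\mathrm{pos}^{(2)}_i(\Psi)-2\,\mathrm{neg}^{(1)}_i(\Psi)-\mathrm{neg}^{(2)}_i(\Psi)\right|.$$ -}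

module Defs where

open import Data.Bool.Base using (Bool; true; false; not; T)
open import Data.Bool.Properties using (T?)
open import Data.Fin.Base using (Fin)
import Data.Fin.Properties as Fin
open import Data.Integer.Base as ℤ using (+_; ∣_∣)
open import Data.List.Base using (List; []; _∷_; [_]; _++_; map; filter; length; allFin)
open import Data.List.Extrema.Nat using (max)
open import Data.List.Membership.Propositional using (_∈_)
open import Data.List.Membership.Propositional.Properties using (∈-map⁺; ∈-++⁺ˡ; ∈-++⁺ʳ)
import Data.List.Membership.DecPropositional as DecMembership
open import Data.List.Relation.Unary.Any using (Any; here; any?)
open import Data.Nat.Base as ℕ using (ℕ; zero; suc)
open import Data.Nat.ListAction using (sum)
import Data.Nat.Properties as ℕ
open import Data.Rational.Base as ℚ using (ℚ; ½)
open import Data.Vec.Base as Vec using (Vec; lookup)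
open import Relation.Binary.Definitions using (DecidableEquality)
open import Relation.Binary.PropositionalEquality using (_≡_; _≢_; refl; cong)
open import Relation.Nullary.Decidable using (Dec; yes; no; map′; _×-dec_)

data Literal (n : ℕ) : Set where
  plain negated : Fin n → Literal n

variableOf : ∀ {n} → Literal n → Fin n
variableOf (plain i)   = i
variableOf (negated i) = i

_≟ˡ_ : ∀ {n} → DecidableEquality (Literal n)
plain i   ≟ˡ plain j   = map′ (cong plain) (λ { refl → refl }) (i Fin.≟ j)
plain i   ≟ˡ negated j = no λ ()
negated i ≟ˡ plain j   = no λ ()
negated i ≟ˡ negated j = map′ (cong negated) (λ { refl → refl }) (i Fin.≟ j)

-- Requiring distinct variables excludes both repeated literals and tautologies.
data Clause (n : ℕ) : Set where
  unit : Literal n → Clause n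
  disj : (l l′ : Literal n) → variableOf l ≢ variableOf l′ → Clause n

literals : ∀ {n} → Clause n → List (Literal n)
literals (unit l)    = [ l ]
literals (disj l l′ _) = l ∷ l′ ∷ []

arity : ∀ {n} → Clause n → ℕ
arity c = length (literals c)

-- A list, so a clause may occur several times and is then counted repeatedly.
Max2OR : ℕ → Set
Max2OR n = List (Clause n)

Assignment : ℕ → Set
Assignment n = Vec Bool n

eval : ∀ {n} → Assignment n → Literal n → Bool
eval a (plain i)   = lookup a i
eval a (negated i) = not (lookup a i)

Satisfies : ∀ {n} → Assignment n → Clause n → Set
Satisfies a c = Any (λ l → T (eval a l)) (literals c)

satisfies? : ∀ {n} (a : Assignment n) (c : Clause n) → Dec (Satisfies a c)
satisfies? a c = any? (λ l → T? (eval a l)) (literals c)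

numSatisfied : ∀ {n} → Max2OR n → Assignment n → ℕ
numSatisfied Ψ a = length (filter (satisfies? a) Ψ)

assignments : ∀ n → List (Assignment n)
assignments zero    = [ Vec.[] ]
assignments (suc n) =
  map (true Vec.∷_) (assignments n) ++ map (false Vec.∷_) (assignments n)

∈-assignments : ∀ {n} (a : Assignment n) → a ∈ assignments n
∈-assignments Vec.[]            = here refl
∈-assignments (true  Vec.∷ a)   = ∈-++⁺ˡ (∈-map⁺ (true Vec.∷_) (∈-assignments a))
∈-assignments {suc n} (false Vec.∷ a) =
  ∈-++⁺ʳ (map (true Vec.∷_) (assignments n)) (∈-map⁺ (false Vec.∷_) (∈-assignments a))

-- The base value 0 does not affect the maximum: `assignments n` is nonempty
-- and all counts are natural numbers.
val : ∀ {n} → Max2OR n → ℕ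
val {n} Ψ = max 0 (map (numSatisfied Ψ) (assignments n))

numClauses : ∀ {n} → ℕ → Max2OR n → ℕ
numClauses r Ψ = length (filter (λ c → arity c ℕ.≟ r) Ψ)

occurrences : ∀ {n} → ℕ → Literal n → Max2OR n → ℕ
occurrences r l Ψ = length (filter (λ c → (arity c ℕ.≟ r) ×-dec (l ∈? literals c)) Ψ)
  where open DecMembership _≟ˡ_ using (_∈?_)

pos neg : ∀ {n} → ℕ → Fin n → Max2OR n → ℕ
pos r i = occurrences r (plain i)
neg r i = occurrences r (negated i)

fromℕ : ℕ → ℚ
fromℕ k = + k ℚ./ 1

infixl 7 _÷ℕ_

_÷ℕ_ : ℚ → (d : ℕ) → .{{ℕ.NonZero d}} → ℚ
p ÷ℕ d = p ℚ.* (+ 1 ℚ./ d)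

imbalance : ∀ {n} → Max2OR n → Fin n → ℕ
imbalance Ψ i =
  ∣ + 2 ℤ.* + pos 1 i Ψ ℤ.+ + pos 2 i Ψ ℤ.- + 2 ℤ.* + neg 1 i Ψ ℤ.- + neg 2 i Ψ ∣

bias : ∀ {n} → Max2OR n → ℚ
bias {n} Ψ = ½ ℚ.* fromℕ (sum (map (imbalance Ψ) (allFin n)))

-- Let γ ∈ [0,1] and set each variable, independently, to its majority value
-- with probability (1+γ)/2. A 1-clause whose literal has sign τ = ±1 relative
-- to the majority holds with probability 1/2 + γτ/2, and a 2-clause with
-- probability 3/4 + γ(τ+τ′)/4 − γ²ττ′/4 ≥ 3/4 + γ(τ+τ′)/4 − γ²/4.
-- Summing the τ's by variables instead of by clauses produces the bias, so
-- val ≥ m₁/2 + (3−γ²)m₂/4 + γ·bias/2. Take γ = 1 for the first bound and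
-- γ = bias/m₂ for the second.
module Submission where

open import Defs
open import Data.Bool.Base using (Bool; true; false; not; _∧_; _∨_; if_then_else_)
open import Data.Bool.Properties using (∨-identityʳ)
open import Data.Fin.Base using (Fin; zero; suc)
import Data.Fin.Properties as Fin
open import Data.Integer.Base as ℤ using (ℤ; +_; -[1+_])
import Data.Integer.Properties as ℤ
import Data.Integer.Solver as ℤSolver
open import Data.List.Base using ([]; _∷_; map; filter; length; tabulate; allFin)
open import Data.List.Extrema.Nat using (xs≤max)
import Data.List.Membership.DecPropositional as DecMembership
open import Data.List.Membership.Propositional.Properties using (∈-map⁺)
open import Data.List.Properties using (map-tabulate)
import Data.List.Relation.Unary.All as All
open import Data.Nat.Base as ℕ using (ℕ; zero; suc)
open import Data.Nat.ListAction using () renaming (sum to sumℕ)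
import Data.Nat.Properties as ℕ
open import Data.Nat.Properties using (m*n≢0)
open import Data.Product.Base using (_×_; _,_; proj₁; proj₂)
open import Data.Rational.Base using (ℚ; 0ℚ; 1ℚ; ½; _+_; _*_; -_; _-_; _/_; _≤_; _≥_; toℚᵘ; NonNegative; nonNegative)
open import Data.Rational.Properties
open import Data.Rational.Solver using (module +-*-Solver)
import Data.Rational.Unnormalised.Base as ℚᵘ
import Data.Rational.Unnormalised.Properties as ℚᵘ
open import Data.Vec.Base as Vec using (lookup)
open import Data.Vec.Properties using (lookup∘tabulate)
open import Function.Base using (_∘_; id)
open import Relation.Binary.PropositionalEquality using (_≡_; _≢_; refl; sym; trans; cong; cong₂; subst; module ≡-Reasoning)
open import Relation.Nullary.Decidable using (does; yes; no; toWitness; _×-dec_)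
open import Relation.Nullary.Negation using (contradiction)
open import Relation.Unary using (Pred; Decidable)

open import Algebra.Properties.CommutativeMonoid.Sum +-0-commutativeMonoid using (sum; sum-cong-≗; ∑-distrib-+; sum-replicate-zero)
open +-*-Solver using (solve; _:=_; _:+_; _:*_; _:-_; :-_; con)

private
  variable
    n : ℕ

-- Integers and naturals inside the rationals.

¼ ¾ 2ℚ : ℚ
¼ = + 1 / 4
¾ = + 3 / 4
2ℚ = + 2 / 1

fromℤ : ℤ → ℚ
fromℤ z = z / 1

-- Reduction to lowest terms is stuck on an open numerator. Unnormalised fractions over 1 compute,
-- so the laws for `fromℤ` are transported from there.
toℚᵘ-fromℤ : ∀ z → toℚᵘ (fromℤ z) ℚᵘ.≃ ℚᵘ.mkℚᵘ z 0
toℚᵘ-fromℤ z = toℚᵘ-fromℚᵘ (ℚᵘ.mkℚᵘ z 0)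

fromℤ-homo-+ : ∀ x y → fromℤ (x ℤ.+ y) ≡ fromℤ x + fromℤ y
fromℤ-homo-+ x y = toℚᵘ-injective (begin
  toℚᵘ (fromℤ (x ℤ.+ y))                ≈⟨ toℚᵘ-fromℤ (x ℤ.+ y) ⟩
  ℚᵘ.mkℚᵘ (x ℤ.+ y) 0                   ≈⟨ ℚᵘ.*≡* (cong (ℤ._* + 1) (sym (cong₂ ℤ._+_ (ℤ.*-identityʳ x) (ℤ.*-identityʳ y)))) ⟩
  ℚᵘ.mkℚᵘ x 0 ℚᵘ.+ ℚᵘ.mkℚᵘ y 0          ≈⟨ ℚᵘ.+-cong (toℚᵘ-fromℤ x) (toℚᵘ-fromℤ y) ⟨
  toℚᵘ (fromℤ x) ℚᵘ.+ toℚᵘ (fromℤ y)    ≈⟨ toℚᵘ-homo-+ (fromℤ x) (fromℤ y) ⟨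
  toℚᵘ (fromℤ x + fromℤ y)              ∎)
  where open import Relation.Binary.Reasoning.Setoid ℚᵘ.≃-setoid

fromℤ-homo-* : ∀ x y → fromℤ (x ℤ.* y) ≡ fromℤ x * fromℤ y
fromℤ-homo-* x y = toℚᵘ-injective (begin
  toℚᵘ (fromℤ (x ℤ.* y))                ≈⟨ toℚᵘ-fromℤ (x ℤ.* y) ⟩
  ℚᵘ.mkℚᵘ x 0 ℚᵘ.* ℚᵘ.mkℚᵘ y 0          ≈⟨ ℚᵘ.*-cong (toℚᵘ-fromℤ x) (toℚᵘ-fromℤ y) ⟨
  toℚᵘ (fromℤ x) ℚᵘ.* toℚᵘ (fromℤ y)    ≈⟨ toℚᵘ-homo-* (fromℤ x) (fromℤ y) ⟨
  toℚᵘ (fromℤ x * fromℤ y)              ∎)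
  where open import Relation.Binary.Reasoning.Setoid ℚᵘ.≃-setoid

fromℤ-homo-neg : ∀ x → fromℤ (ℤ.- x) ≡ - fromℤ x
fromℤ-homo-neg (+ zero)  = refl
fromℤ-homo-neg (+ suc k) = refl
-- A fraction with negative numerator is by definition the negation of the positive one, so only
-- double negation remains.
fromℤ-homo-neg -[1+ k ]  = solve 1 (λ x → x := :- (:- x)) refl (fromℕ (suc k))

fromℤ-homo-minus : ∀ x y → fromℤ (x ℤ.- y) ≡ fromℤ x - fromℤ y
fromℤ-homo-minus x y = trans (fromℤ-homo-+ x (ℤ.- y)) (cong (_+_ (fromℤ x)) (fromℤ-homo-neg y))

fromℕ-homo-* : ∀ x y → fromℕ (x ℕ.* y) ≡ fromℕ x * fromℕ y
fromℕ-homo-* x y = trans (cong fromℤ (ℤ.pos-* x y)) (fromℤ-homo-* (+ x) (+ y))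

fromℕ-mono-≤ : ∀ {x y} → x ℕ.≤ y → fromℕ x ≤ fromℕ y
fromℕ-mono-≤ {x} {y} x≤y = toℚᵘ-cancel-≤ (begin
  toℚᵘ (fromℕ x)     ≃⟨ toℚᵘ-fromℤ (+ x) ⟩
  ℚᵘ.mkℚᵘ (+ x) 0    ≤⟨ ℚᵘ.*≤* (ℤ.*-monoʳ-≤-nonNeg (+ 1) (ℤ.+≤+ x≤y)) ⟩
  ℚᵘ.mkℚᵘ (+ y) 0    ≃⟨ toℚᵘ-fromℤ (+ y) ⟨
  toℚᵘ (fromℕ y)     ∎)
  where open ℚᵘ.≤-Reasoning

fromℕ*1/ : ∀ d .{{_ : ℕ.NonZero d}} → fromℕ d * (+ 1 / d) ≡ 1ℚ
fromℕ*1/ (suc d) = toℚᵘ-injective (begin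
  toℚᵘ (fromℕ (suc d) * (+ 1 / suc d))              ≈⟨ toℚᵘ-homo-* (fromℕ (suc d)) (+ 1 / suc d) ⟩
  toℚᵘ (fromℕ (suc d)) ℚᵘ.* toℚᵘ (+ 1 / suc d)      ≈⟨ ℚᵘ.*-cong (toℚᵘ-fromℤ (+ suc d)) (toℚᵘ-fromℚᵘ (ℚᵘ.mkℚᵘ (+ 1) d)) ⟩
  ℚᵘ.mkℚᵘ (+ suc d) 0 ℚᵘ.* ℚᵘ.mkℚᵘ (+ 1) d          ≈⟨ ℚᵘ.*≡* (ℤSolver.+-*-Solver.solve 1 (λ x → (x ℤ:* ℤcon (+ 1)) ℤ:* ℤcon (+ 1) ℤ:= ℤcon (+ 1) ℤ:* (ℤcon (+ 1) ℤ:* x)) refl (+ suc d)) ⟩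
  ℚᵘ.1ℚᵘ                                            ∎)
  where
  open import Relation.Binary.Reasoning.Setoid ℚᵘ.≃-setoid
  open ℤSolver.+-*-Solver using () renaming (_:*_ to _ℤ:*_; _:=_ to _ℤ:=_; con to ℤcon)

fromℕ-sum-tabulate : ∀ {n} (f : Fin n → ℕ) → fromℕ (sumℕ (tabulate f)) ≡ sum (fromℕ ∘ f)
fromℕ-sum-tabulate {zero}  f = refl
fromℕ-sum-tabulate {suc n} f =
  trans (fromℤ-homo-+ (+ f zero) (+ sumℕ (tabulate (f ∘ suc)))) (cong (_+_ (fromℕ (f zero))) (fromℕ-sum-tabulate (f ∘ suc)))

p≤q⇒0≤q-p : ∀ {p q} → p ≤ q → 0ℚ ≤ q - p
p≤q⇒0≤q-p {p} {q} p≤q = subst (_≤ q - p) (+-inverseʳ p) (+-monoˡ-≤ (- p) p≤q)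

-- Indicators, counts and finite sums.

𝟙 : Bool → ℚ
𝟙 b = if b then 1ℚ else 0ℚ

fromℕ-length-filter-∷ : ∀ {a p} {A : Set a} {P : Pred A p} (P? : Decidable P) x xs →
  fromℕ (length (filter P? (x ∷ xs))) ≡ 𝟙 (does (P? x)) + fromℕ (length (filter P? xs))
fromℕ-length-filter-∷ P? x xs with does (P? x)
... | true  = fromℤ-homo-+ (+ 1) (+ length (filter P? xs))
... | false = sym (+-identityˡ _)

sum-indicator : (f : Fin n → ℚ) (j : Fin n) → sum (λ i → f i * 𝟙 (does (i Fin.≟ j))) ≡ f j
sum-indicator {suc n} f zero = begin
  f zero * 1ℚ + sum (λ i → f (suc i) * 0ℚ)  ≡⟨ cong₂ _+_ (*-identityʳ (f zero)) (sum-cong-≗ (*-zeroʳ ∘ f ∘ suc)) ⟩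
  f zero + sum {n} (λ _ → 0ℚ)               ≡⟨ cong (_+_ (f zero)) (sum-replicate-zero n) ⟩
  f zero + 0ℚ                               ≡⟨ +-identityʳ (f zero) ⟩
  f zero                                    ∎
  where open ≡-Reasoning
sum-indicator {suc n} f (suc j) =
  trans (cong₂ _+_ (*-zeroʳ (f zero)) (sum-indicator (f ∘ suc) j)) (+-identityˡ _)

-- Expectation under independent coin flips.

mix : ℚ → ℚ → ℚ → ℚ
mix p x y = p * x + (1ℚ - p) * y

mix-same : ∀ p x → mix p x x ≡ x
mix-same = solve 2 (λ p x → p :* x :+ (con 1ℚ :- p) :* x := x) refl

-- Expectation when x_i is true with probability p i, independently.
𝔼 : (Fin n → ℚ) → (Assignment n → ℚ) → ℚ
𝔼 {zero}  p F = F Vec.[]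
𝔼 {suc n} p F = mix (p zero) (𝔼 (p ∘ suc) (F ∘ (true Vec.∷_))) (𝔼 (p ∘ suc) (F ∘ (false Vec.∷_)))

𝔼-cong : (p : Fin n → ℚ) {F G : Assignment n → ℚ} → (∀ a → F a ≡ G a) → 𝔼 p F ≡ 𝔼 p G
𝔼-cong {zero}  p F≗G = F≗G Vec.[]
𝔼-cong {suc n} p F≗G =
  cong₂ (mix (p zero)) (𝔼-cong (p ∘ suc) (F≗G ∘ (true Vec.∷_))) (𝔼-cong (p ∘ suc) (F≗G ∘ (false Vec.∷_)))

𝔼-const : (p : Fin n → ℚ) (c : ℚ) → 𝔼 p (λ _ → c) ≡ c
𝔼-const {zero}  p c = refl
𝔼-const {suc n} p c = trans (cong₂ (mix (p zero)) (𝔼-const (p ∘ suc) c) (𝔼-const (p ∘ suc) c)) (mix-same (p zero) c)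

𝔼-+ : (p : Fin n → ℚ) (F G : Assignment n → ℚ) → 𝔼 p (λ a → F a + G a) ≡ 𝔼 p F + 𝔼 p G
𝔼-+ {zero}  p F G = refl
𝔼-+ {suc n} p F G =
  trans (cong₂ (mix (p zero)) (𝔼-+ (p ∘ suc) _ _) (𝔼-+ (p ∘ suc) _ _))
        (solve 5 (λ p x y z w → p :* (x :+ y) :+ (con 1ℚ :- p) :* (z :+ w)
                             := (p :* x :+ (con 1ℚ :- p) :* z) :+ (p :* y :+ (con 1ℚ :- p) :* w))
               refl (p zero) _ _ _ _)

𝔼-* : (p : Fin n → ℚ) (c : ℚ) (F : Assignment n → ℚ) → 𝔼 p (λ a → c * F a) ≡ c * 𝔼 p F
𝔼-* {zero}  p c F = refl
𝔼-* {suc n} p c F =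
  trans (cong₂ (mix (p zero)) (𝔼-* (p ∘ suc) c _) (𝔼-* (p ∘ suc) c _))
        (solve 4 (λ p c x y → p :* (c :* x) :+ (con 1ℚ :- p) :* (c :* y) := c :* (p :* x :+ (con 1ℚ :- p) :* y))
               refl (p zero) c _ _)

-- The averaging argument: weights in [0,1] make every `mix` a convex combination, hence monotone.
-- With `M` the value of the instance, a lower bound on the expectation becomes one on `val`,
-- without exhibiting a good assignment.
𝔼-upper : (p : Fin n → ℚ) → (∀ i → 0ℚ ≤ p i) → (∀ i → p i ≤ 1ℚ) →
          ∀ {F M} → (∀ a → F a ≤ M) → 𝔼 p F ≤ M
𝔼-upper {zero}  p 0≤p p≤1 F≤M = F≤M Vec.[]
𝔼-upper {suc n} p 0≤p p≤1 {F} {M} F≤M = begin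
  mix (p zero) (𝔼 (p ∘ suc) (F ∘ (true Vec.∷_))) (𝔼 (p ∘ suc) (F ∘ (false Vec.∷_)))
    ≤⟨ +-mono-≤ (*-monoˡ-≤-nonNeg (p zero) {{nonNegative (0≤p zero)}} (𝔼-upper (p ∘ suc) (0≤p ∘ suc) (p≤1 ∘ suc) (F≤M ∘ (true Vec.∷_))))
                (*-monoˡ-≤-nonNeg (1ℚ - p zero) {{nonNegative (p≤q⇒0≤q-p (p≤1 zero))}} (𝔼-upper (p ∘ suc) (0≤p ∘ suc) (p≤1 ∘ suc) (F≤M ∘ (false Vec.∷_)))) ⟩
  mix (p zero) M M
    ≡⟨ mix-same (p zero) M ⟩
  M ∎
  where open ≤-Reasoning

𝔼-lookup : (p : Fin n → ℚ) (f : Bool → ℚ) (i : Fin n) →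
           𝔼 p (λ a → f (lookup a i)) ≡ mix (p i) (f true) (f false)
𝔼-lookup p f zero    = cong₂ (mix (p zero)) (𝔼-const (p ∘ suc) (f true)) (𝔼-const (p ∘ suc) (f false))
𝔼-lookup p f (suc i) = trans (mix-same (p zero) _) (𝔼-lookup (p ∘ suc) f i)

-- Independence of distinct coordinates. When one of them is the head, the factor of the other is
-- common to both branches of the mixture and comes out. Arbitrary `f` and `g` cover plain and
-- negated literals at once.
𝔼-lookup-* : (p : Fin n → ℚ) (f g : Bool → ℚ) {i j : Fin n} → i ≢ j →
             𝔼 p (λ a → f (lookup a i) * g (lookup a j)) ≡
             mix (p i) (f true) (f false) * mix (p j) (g true) (g false)
𝔼-lookup-* p f g {zero}  {zero}  i≢j = contradiction refl i≢j
𝔼-lookup-* p f g {zero}  {suc j} i≢j = begin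
  mix (p zero) (𝔼 (p ∘ suc) (λ a → f true * g (lookup a j))) (𝔼 (p ∘ suc) (λ a → f false * g (lookup a j)))
    ≡⟨ cong₂ (mix (p zero)) (𝔼-* (p ∘ suc) (f true) _) (𝔼-* (p ∘ suc) (f false) _) ⟩
  mix (p zero) (f true * 𝔼 (p ∘ suc) (λ a → g (lookup a j))) (f false * 𝔼 (p ∘ suc) (λ a → g (lookup a j)))
    ≡⟨ solve 4 (λ p x y e → p :* (x :* e) :+ (con 1ℚ :- p) :* (y :* e) := (p :* x :+ (con 1ℚ :- p) :* y) :* e) refl (p zero) (f true) (f false) _ ⟩
  mix (p zero) (f true) (f false) * 𝔼 (p ∘ suc) (λ a → g (lookup a j))
    ≡⟨ cong (mix (p zero) (f true) (f false) *_) (𝔼-lookup (p ∘ suc) g j) ⟩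
  mix (p zero) (f true) (f false) * mix (p (suc j)) (g true) (g false) ∎
  where open ≡-Reasoning
𝔼-lookup-* p f g {suc i} {zero}  i≢j =
  trans (𝔼-cong p (λ a → *-comm (f (lookup a (suc i))) (g (lookup a zero))))
        (trans (𝔼-lookup-* p g f {zero} {suc i} (i≢j ∘ sym)) (*-comm (mix (p zero) _ _) _))
𝔼-lookup-* p f g {suc i} {suc j} i≢j =
  trans (mix-same (p zero) _) (𝔼-lookup-* (p ∘ suc) f g (i≢j ∘ cong suc))

-- Satisfaction probabilities of literals and clauses.

prob : (Fin n → ℚ) → Literal n → ℚ
prob p (plain i)   = p i
prob p (negated i) = 1ℚ - p i

-- A literal as a function of the bit of its variable, the form that `𝔼-lookup` and `𝔼-lookup-*`
-- expect.
evalAt : Literal n → Bool → Bool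
evalAt (plain _)   = id
evalAt (negated _) = not

eval≡evalAt : (a : Assignment n) (l : Literal n) → eval a l ≡ evalAt l (lookup a (variableOf l))
eval≡evalAt a (plain i)   = refl
eval≡evalAt a (negated i) = refl

mix-evalAt : (p : Fin n → ℚ) (l : Literal n) →
             mix (p (variableOf l)) (𝟙 (evalAt l true)) (𝟙 (evalAt l false)) ≡ prob p l
mix-evalAt p (plain i)   = solve 1 (λ p → p :* con 1ℚ :+ (con 1ℚ :- p) :* con 0ℚ := p) refl (p i)
mix-evalAt p (negated i) = solve 1 (λ p → p :* con 0ℚ :+ (con 1ℚ :- p) :* con 1ℚ := con 1ℚ :- p) refl (p i)

𝔼-literal : (p : Fin n → ℚ) (l : Literal n) → 𝔼 p (λ a → 𝟙 (eval a l)) ≡ prob p l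
𝔼-literal p l =
  trans (𝔼-cong p (λ a → cong 𝟙 (eval≡evalAt a l)))
        (trans (𝔼-lookup p (𝟙 ∘ evalAt l) (variableOf l)) (mix-evalAt p l))

𝔼-literal-* : (p : Fin n → ℚ) (l l′ : Literal n) → variableOf l ≢ variableOf l′ →
              𝔼 p (λ a → 𝟙 (eval a l) * 𝟙 (eval a l′)) ≡ prob p l * prob p l′
𝔼-literal-* p l l′ l≢l′ =
  trans (𝔼-cong p (λ a → cong₂ (λ x y → 𝟙 x * 𝟙 y) (eval≡evalAt a l) (eval≡evalAt a l′)))
        (trans (𝔼-lookup-* p (𝟙 ∘ evalAt l) (𝟙 ∘ evalAt l′) l≢l′)
               (cong₂ _*_ (mix-evalAt p l) (mix-evalAt p l′)))

-- Inclusion-exclusion, with the difference written as a multiple of `- 1ℚ` so that `𝔼-+` and `𝔼-*`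
-- apply directly.
satProb : (Fin n → ℚ) → Clause n → ℚ
satProb p (unit l)      = prob p l
satProb p (disj l l′ _) = prob p l + (prob p l′ + - 1ℚ * (prob p l * prob p l′))

-- The trailing `∨ false` is what `any?` leaves at the end of a list of two literals.
𝟙-∨ : ∀ x y → 𝟙 (x ∨ (y ∨ false)) ≡ 𝟙 x + (𝟙 y + - 1ℚ * (𝟙 x * 𝟙 y))
𝟙-∨ true  true  = refl
𝟙-∨ true  false = refl
𝟙-∨ false true  = refl
𝟙-∨ false false = refl

𝔼-satisfies : (p : Fin n → ℚ) (c : Clause n) → 𝔼 p (λ a → 𝟙 (does (satisfies? a c))) ≡ satProb p c
𝔼-satisfies p (unit l) = trans (𝔼-cong p (λ a → cong 𝟙 (∨-identityʳ (eval a l)))) (𝔼-literal p l)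
𝔼-satisfies p (disj l l′ l≢l′) = begin
  𝔼 p (λ a → 𝟙 (eval a l ∨ (eval a l′ ∨ false)))
    ≡⟨ 𝔼-cong p (λ a → 𝟙-∨ (eval a l) (eval a l′)) ⟩
  𝔼 p (λ a → 𝟙 (eval a l) + (𝟙 (eval a l′) + - 1ℚ * (𝟙 (eval a l) * 𝟙 (eval a l′))))
    ≡⟨ 𝔼-+ p _ _ ⟩
  𝔼 p (λ a → 𝟙 (eval a l)) + 𝔼 p (λ a → 𝟙 (eval a l′) + - 1ℚ * (𝟙 (eval a l) * 𝟙 (eval a l′)))
    ≡⟨ cong₂ _+_ (𝔼-literal p l) (𝔼-+ p _ _) ⟩
  prob p l + (𝔼 p (λ a → 𝟙 (eval a l′)) + 𝔼 p (λ a → - 1ℚ * (𝟙 (eval a l) * 𝟙 (eval a l′))))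
    ≡⟨ cong (_+_ (prob p l)) (cong₂ _+_ (𝔼-literal p l′) (trans (𝔼-* p (- 1ℚ) _) (cong (_*_ (- 1ℚ)) (𝔼-literal-* p l l′ l≢l′)))) ⟩
  satProb p (disj l l′ l≢l′) ∎
  where open ≡-Reasoning

𝔼-numSatisfied-∷ : (p : Fin n → ℚ) (c : Clause n) (Ψ : Max2OR n) →
  𝔼 p (fromℕ ∘ numSatisfied (c ∷ Ψ)) ≡ satProb p c + 𝔼 p (fromℕ ∘ numSatisfied Ψ)
𝔼-numSatisfied-∷ p c Ψ =
  trans (𝔼-cong p (λ a → fromℕ-length-filter-∷ (satisfies? a) c Ψ))
        (trans (𝔼-+ p _ _) (cong (_+ 𝔼 p (fromℕ ∘ numSatisfied Ψ)) (𝔼-satisfies p c)))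

numSatisfied≤val : (Ψ : Max2OR n) (a : Assignment n) → numSatisfied Ψ a ℕ.≤ val Ψ
numSatisfied≤val {n} Ψ a =
  All.lookup (xs≤max 0 (map (numSatisfied Ψ) (assignments n))) (∈-map⁺ (numSatisfied Ψ) (∈-assignments a))

-- Coins leaning towards a reference assignment, and the bound for one clause.

⟦_⟧ : Bool → ℚ
⟦ true ⟧  = 1ℚ
⟦ false ⟧ = - 1ℚ

-- The reference `b` stays arbitrary until the bias enters, where it becomes the majority. The sign
-- τ of a literal `l` is `⟦ eval b l ⟧`.
coin : Assignment n → ℚ → Fin n → ℚ
coin b γ i = ½ + ½ * γ * ⟦ lookup b i ⟧

-- Negating a literal flips τ, and 1 - (½ + ½γτ) = ½ - ½γτ, so both kinds of literal share one
-- formula.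
prob-coin : (b : Assignment n) (γ : ℚ) (l : Literal n) → prob (coin b γ) l ≡ ½ + ½ * γ * ⟦ eval b l ⟧
prob-coin b γ (plain i)   = refl
prob-coin b γ (negated i) with lookup b i
... | true  = solve 1 (λ γ → con 1ℚ :- (con ½ :+ con ½ :* γ :* con 1ℚ) := con ½ :+ con ½ :* γ :* con (- 1ℚ)) refl γ
... | false = solve 1 (λ γ → con 1ℚ :- (con ½ :+ con ½ :* γ :* con (- 1ℚ)) := con ½ :+ con ½ :* γ :* con 1ℚ) refl γ

½*-bounds : ∀ {γ} → 0ℚ ≤ γ → γ ≤ 1ℚ → (x : Bool) →
            0ℚ ≤ ½ + ½ * γ * ⟦ x ⟧ × ½ + ½ * γ * ⟦ x ⟧ ≤ 1ℚ
½*-bounds {γ} 0≤γ γ≤1 true =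
  subst (0ℚ ≤_) e (+-mono-≤ (nonNegative⁻¹ ½) 0≤½γ) , subst (_≤ 1ℚ) e (+-monoʳ-≤ ½ ½γ≤½)
  where
  e : ½ + ½ * γ ≡ ½ + ½ * γ * 1ℚ
  e = cong (_+_ ½) (sym (*-identityʳ (½ * γ)))
  0≤½γ : 0ℚ ≤ ½ * γ
  0≤½γ = *-monoˡ-≤-nonNeg ½ 0≤γ
  ½γ≤½ : ½ * γ ≤ ½
  ½γ≤½ = *-monoˡ-≤-nonNeg ½ γ≤1
½*-bounds {γ} 0≤γ γ≤1 false =
  subst (0ℚ ≤_) e (p≤q⇒0≤q-p (*-monoˡ-≤-nonNeg ½ γ≤1)) ,
  subst (_≤ 1ℚ) e (≤-trans (+-monoʳ-≤ ½ (neg-antimono-≤ (*-monoˡ-≤-nonNeg ½ 0≤γ))) (toWitness {a? = ½ + 0ℚ ≤? 1ℚ} _))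
  where
  e : ½ - ½ * γ ≡ ½ + ½ * γ * - 1ℚ
  e = solve 1 (λ γ → con ½ :- con ½ :* γ := con ½ :+ con ½ :* γ :* con (- 1ℚ)) refl γ

-- Counting the literal of a 1-clause twice lets one factor ¼γ serve both arities, and matches the
-- coefficient 2 in `imbalance`.
weight : Assignment n → Clause n → ℚ
weight b (unit l)      = ⟦ eval b l ⟧ + ⟦ eval b l ⟧
weight b (disj l l′ _) = ⟦ eval b l ⟧ + ⟦ eval b l′ ⟧

-- Linear in the last three arguments jointly, so the bounds of single clauses add up to the bound
-- of the instance.
linearBound : ℚ → ℚ → ℚ → ℚ → ℚ
linearBound γ m₁ m₂ w = ½ * m₁ + (¾ - ¼ * (γ * γ)) * m₂ + ¼ * γ * w

linearBound-+ : ∀ γ m₁ m₂ w m₁′ m₂′ w′ →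
  linearBound γ (m₁ + m₁′) (m₂ + m₂′) (w + w′) ≡ linearBound γ m₁ m₂ w + linearBound γ m₁′ m₂′ w′
linearBound-+ = solve 7 (λ γ m₁ m₂ w m₁′ m₂′ w′ →
  con ½ :* (m₁ :+ m₁′) :+ (con ¾ :- con ¼ :* (γ :* γ)) :* (m₂ :+ m₂′) :+ con ¼ :* γ :* (w :+ w′)
  := (con ½ :* m₁ :+ (con ¾ :- con ¼ :* (γ :* γ)) :* m₂ :+ con ¼ :* γ :* w)
  :+ (con ½ :* m₁′ :+ (con ¾ :- con ¼ :* (γ :* γ)) :* m₂′ :+ con ¼ :* γ :* w′)) refl

0≤1-⟦⟧*⟦⟧ : ∀ x y → 0ℚ ≤ 1ℚ - ⟦ x ⟧ * ⟦ y ⟧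
0≤1-⟦⟧*⟦⟧ true  true  = nonNegative⁻¹ _
0≤1-⟦⟧*⟦⟧ true  false = nonNegative⁻¹ _
0≤1-⟦⟧*⟦⟧ false true  = nonNegative⁻¹ _
0≤1-⟦⟧*⟦⟧ false false = nonNegative⁻¹ _

-- A 1-clause gives equality. For a 2-clause the gap is ¼γ²(1 - ττ′), nonnegative because ττ′ is ±1.
linearBound≤satProb : (b : Assignment n) {γ : ℚ} → 0ℚ ≤ γ → (c : Clause n) →
  linearBound γ (𝟙 (does (arity c ℕ.≟ 1))) (𝟙 (does (arity c ℕ.≟ 2))) (weight b c) ≤ satProb (coin b γ) c
linearBound≤satProb b {γ} 0≤γ (unit l) = ≤-reflexive (trans
  (solve 2 (λ γ t → con ½ :* con 1ℚ :+ (con ¾ :- con ¼ :* (γ :* γ)) :* con 0ℚ :+ con ¼ :* γ :* (t :+ t)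
                 := con ½ :+ con ½ :* γ :* t) refl γ ⟦ eval b l ⟧)
  (sym (prob-coin b γ l)))
linearBound≤satProb b {γ} 0≤γ (disj l l′ _) = begin
  B
    ≡⟨ +-identityʳ B ⟨
  B + 0ℚ
    ≤⟨ +-monoʳ-≤ B (nonNegative⁻¹ _ {{nonNeg*nonNeg⇒nonNeg (¼ * (γ * γ)) {{nonNeg*nonNeg⇒nonNeg ¼ (γ * γ) {{nonNeg*nonNeg⇒nonNeg γ {{nonNegative 0≤γ}} γ {{nonNegative 0≤γ}}}}}}
                                                           (1ℚ - t * t′) {{nonNegative (0≤1-⟦⟧*⟦⟧ (eval b l) (eval b l′))}}}}) ⟩
  B + ¼ * (γ * γ) * (1ℚ - t * t′)
    ≡⟨ solve 3 (λ γ t t′ →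
         con ½ :* con 0ℚ :+ (con ¾ :- con ¼ :* (γ :* γ)) :* con 1ℚ :+ con ¼ :* γ :* (t :+ t′) :+ con ¼ :* (γ :* γ) :* (con 1ℚ :- t :* t′)
         := (con ½ :+ con ½ :* γ :* t) :+ ((con ½ :+ con ½ :* γ :* t′)
            :+ con (- 1ℚ) :* ((con ½ :+ con ½ :* γ :* t) :* (con ½ :+ con ½ :* γ :* t′)))) refl γ t t′ ⟩
  (½ + ½ * γ * t) + ((½ + ½ * γ * t′) + - 1ℚ * ((½ + ½ * γ * t) * (½ + ½ * γ * t′)))
    ≡⟨ cong₂ (λ x y → x + (y + - 1ℚ * (x * y))) (prob-coin b γ l) (prob-coin b γ l′) ⟨
  prob (coin b γ) l + (prob (coin b γ) l′ + - 1ℚ * (prob (coin b γ) l * prob (coin b γ) l′)) ∎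
  where
  open ≤-Reasoning
  t t′ B : ℚ
  t  = ⟦ eval b l ⟧
  t′ = ⟦ eval b l′ ⟧
  B  = linearBound γ 0ℚ 1ℚ (t + t′)

-- Signed occurrence counts, by variable and by clause.

net₄ : ℚ → ℚ → ℚ → ℚ → ℚ
net₄ P₁ P₂ N₁ N₂ = 2ℚ * P₁ + P₂ - 2ℚ * N₁ - N₂

net₄-cong : ∀ {P₁ P₁′ P₂ P₂′ N₁ N₁′ N₂ N₂′} → P₁ ≡ P₁′ → P₂ ≡ P₂′ → N₁ ≡ N₁′ → N₂ ≡ N₂′ →
            net₄ P₁ P₂ N₁ N₂ ≡ net₄ P₁′ P₂′ N₁′ N₂′
net₄-cong refl refl refl refl = refl

-- Here `x` and `y` stand for the indicators that the new literal is the plain or the negated one;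
-- each `0ℚ` is the contribution of a 1-clause to a count of 2-clauses.
net₄-unit : ∀ x y P₁ P₂ N₁ N₂ →
  net₄ (x + P₁) (0ℚ + P₂) (y + N₁) (0ℚ + N₂) ≡ (x - y) + (x - y) + net₄ P₁ P₂ N₁ N₂
net₄-unit = solve 6 (λ x y P₁ P₂ N₁ N₂ →
  con 2ℚ :* (x :+ P₁) :+ (con 0ℚ :+ P₂) :- con 2ℚ :* (y :+ N₁) :- (con 0ℚ :+ N₂)
  := (x :- y) :+ (x :- y) :+ (con 2ℚ :* P₁ :+ P₂ :- con 2ℚ :* N₁ :- N₂)) refl

net₄-disj : ∀ x x′ y y′ P₁ P₂ N₁ N₂ →
  net₄ (0ℚ + P₁) ((x + x′) + P₂) (0ℚ + N₁) ((y + y′) + N₂) ≡ (x - y) + (x′ - y′) + net₄ P₁ P₂ N₁ N₂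
net₄-disj = solve 8 (λ x x′ y y′ P₁ P₂ N₁ N₂ →
  con 2ℚ :* (con 0ℚ :+ P₁) :+ (x :+ x′ :+ P₂) :- con 2ℚ :* (con 0ℚ :+ N₁) :- (y :+ y′ :+ N₂)
  := (x :- y) :+ (x′ :- y′) :+ (con 2ℚ :* P₁ :+ P₂ :- con 2ℚ :* N₁ :- N₂)) refl

net : Max2OR n → Fin n → ℚ
net Ψ i = net₄ (fromℕ (pos 1 i Ψ)) (fromℕ (pos 2 i Ψ)) (fromℕ (neg 1 i Ψ)) (fromℕ (neg 2 i Ψ))

[_≟_] : Literal n → Literal n → ℚ
[ k ≟ l ] = 𝟙 (does (k ≟ˡ l))

-- The signed incidence: 1, -1 or 0 as `l` is the plain literal of `i`, its negation, or on another
-- variable.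
incidence : Literal n → Fin n → ℚ
incidence l i = [ plain i ≟ l ] - [ negated i ≟ l ]

clauseNet : Clause n → Fin n → ℚ
clauseNet (unit l)      i = incidence l i + incidence l i
clauseNet (disj l l′ _) i = incidence l i + incidence l′ i

module _ {n : ℕ} where
  open DecMembership (_≟ˡ_ {n}) using (_∈?_)

  -- Leaving the contribution as a free `x` lets `refl` settle the case of mismatched arity, where
  -- it computes to `0ℚ`.
  occurrences-∷ : ∀ r (k : Literal n) c Ψ {x} → 𝟙 (does (arity c ℕ.≟ r) ∧ does (k ∈? literals c)) ≡ x →
    fromℕ (occurrences r k (c ∷ Ψ)) ≡ x + fromℕ (occurrences r k Ψ)
  occurrences-∷ r k c Ψ refl = fromℕ-length-filter-∷ (λ c → (arity c ℕ.≟ r) ×-dec (k ∈? literals c)) c Ψ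

  𝟙-∈-single : ∀ (k l : Literal n) → 𝟙 (does (k ∈? (l ∷ []))) ≡ [ k ≟ l ]
  𝟙-∈-single k l = cong 𝟙 (∨-identityʳ (does (k ≟ˡ l)))

  -- Distinct variables force distinct literals, so `k` equals at most one of them and no overlap
  -- has to be subtracted.
  𝟙-∈-distinct : ∀ (k l l′ : Literal n) → variableOf l ≢ variableOf l′ →
    𝟙 (does (k ∈? (l ∷ l′ ∷ []))) ≡ [ k ≟ l ] + [ k ≟ l′ ]
  𝟙-∈-distinct k l l′ l≢l′ with k ≟ˡ l | k ≟ˡ l′
  ... | yes refl | yes refl = contradiction refl l≢l′
  ... | yes _    | no _     = refl
  ... | no _     | yes _    = refl
  ... | no _     | no _     = refl

net-∷ : (c : Clause n) (Ψ : Max2OR n) (i : Fin n) → net (c ∷ Ψ) i ≡ clauseNet c i + net Ψ i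
net-∷ c@(unit l) Ψ i = trans
  (net₄-cong (occurrences-∷ 1 (plain i) c Ψ (𝟙-∈-single (plain i) l))
             (occurrences-∷ 2 (plain i) c Ψ refl)
             (occurrences-∷ 1 (negated i) c Ψ (𝟙-∈-single (negated i) l))
             (occurrences-∷ 2 (negated i) c Ψ refl))
  (net₄-unit [ plain i ≟ l ] [ negated i ≟ l ]
             (fromℕ (pos 1 i Ψ)) (fromℕ (pos 2 i Ψ)) (fromℕ (neg 1 i Ψ)) (fromℕ (neg 2 i Ψ)))
net-∷ c@(disj l l′ l≢l′) Ψ i = trans
  (net₄-cong (occurrences-∷ 1 (plain i) c Ψ refl)
             (occurrences-∷ 2 (plain i) c Ψ (𝟙-∈-distinct (plain i) l l′ l≢l′))
             (occurrences-∷ 1 (negated i) c Ψ refl)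
             (occurrences-∷ 2 (negated i) c Ψ (𝟙-∈-distinct (negated i) l l′ l≢l′)))
  (net₄-disj [ plain i ≟ l ] [ plain i ≟ l′ ] [ negated i ≟ l ] [ negated i ≟ l′ ]
             (fromℕ (pos 1 i Ψ)) (fromℕ (pos 2 i Ψ)) (fromℕ (neg 1 i Ψ)) (fromℕ (neg 2 i Ψ)))

-- Only the variable of `l` contributes; for a negated literal the minus sign turns the sign of the
-- bit into the sign of its negation.
sum-incidence : (b : Assignment n) (l : Literal n) → sum (λ i → ⟦ lookup b i ⟧ * incidence l i) ≡ ⟦ eval b l ⟧
sum-incidence b (plain j) = trans
  -- Comparing `negated i` with `plain j` computes to false, so the subtracted indicator is already
  -- `0ℚ`.
  (sum-cong-≗ (λ i → cong (_*_ ⟦ lookup b i ⟧) (+-identityʳ [ plain i ≟ plain j ])))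
  (sum-indicator (λ i → ⟦ lookup b i ⟧) j)
sum-incidence b (negated j) = trans
  (sum-cong-≗ (λ i → solve 2 (λ s x → s :* (con 0ℚ :- x) := (:- s) :* x) refl ⟦ lookup b i ⟧ (𝟙 (does (i Fin.≟ j)))))
  (trans (sum-indicator (λ i → - ⟦ lookup b i ⟧) j) (⟦not⟧ (lookup b j)))
  where
  ⟦not⟧ : ∀ x → - ⟦ x ⟧ ≡ ⟦ not x ⟧
  ⟦not⟧ true  = refl
  ⟦not⟧ false = refl

sum-*-+ : (f g h : Fin n → ℚ) → sum (λ i → f i * (g i + h i)) ≡ sum (λ i → f i * g i) + sum (λ i → f i * h i)
sum-*-+ f g h = trans (sum-cong-≗ (λ i → *-distribˡ-+ (f i) (g i) (h i)))
                      (∑-distrib-+ (λ i → f i * g i) (λ i → f i * h i))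

sum-clauseNet : (b : Assignment n) (c : Clause n) → sum (λ i → ⟦ lookup b i ⟧ * clauseNet c i) ≡ weight b c
sum-clauseNet b (unit l)      =
  trans (sum-*-+ (⟦_⟧ ∘ lookup b) (incidence l) (incidence l)) (cong₂ _+_ (sum-incidence b l) (sum-incidence b l))
sum-clauseNet b (disj l l′ _) =
  trans (sum-*-+ (⟦_⟧ ∘ lookup b) (incidence l) (incidence l′)) (cong₂ _+_ (sum-incidence b l) (sum-incidence b l′))

agreement : Assignment n → Max2OR n → ℚ
agreement b Ψ = sum (λ i → ⟦ lookup b i ⟧ * net Ψ i)

-- Double counting: signs summed over variables are regrouped by clauses, which is the form an
-- induction on the instance can use.
agreement-∷ : (b : Assignment n) (c : Clause n) (Ψ : Max2OR n) → agreement b (c ∷ Ψ) ≡ weight b c + agreement b Ψ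
agreement-∷ b c Ψ = trans
  (sum-cong-≗ (λ i → cong (_*_ ⟦ lookup b i ⟧) (net-∷ c Ψ i)))
  (trans (sum-*-+ (⟦_⟧ ∘ lookup b) (clauseNet c) (net Ψ)) (cong (_+ agreement b Ψ) (sum-clauseNet b c)))

-- Both sides are additive over clauses: the left by `linearBound-+` and `agreement-∷`, the right by
-- linearity of expectation.
linearBound≤𝔼 : (b : Assignment n) {γ : ℚ} → 0ℚ ≤ γ → (Ψ : Max2OR n) →
  linearBound γ (fromℕ (numClauses 1 Ψ)) (fromℕ (numClauses 2 Ψ)) (agreement b Ψ)
    ≤ 𝔼 (coin b γ) (fromℕ ∘ numSatisfied Ψ)
linearBound≤𝔼 {n} b {γ} 0≤γ [] = ≤-reflexive (begin
  linearBound γ 0ℚ 0ℚ (agreement b [])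
    ≡⟨ cong (linearBound γ 0ℚ 0ℚ) (trans (sum-cong-≗ (λ i → *-zeroʳ ⟦ lookup b i ⟧)) (sum-replicate-zero n)) ⟩
  linearBound γ 0ℚ 0ℚ 0ℚ
    ≡⟨ solve 1 (λ γ → con ½ :* con 0ℚ :+ (con ¾ :- con ¼ :* (γ :* γ)) :* con 0ℚ :+ con ¼ :* γ :* con 0ℚ := con 0ℚ) refl γ ⟩
  0ℚ
    ≡⟨ 𝔼-const (coin b γ) 0ℚ ⟨
  𝔼 (coin b γ) (fromℕ ∘ numSatisfied []) ∎)
  where open ≡-Reasoning
linearBound≤𝔼 b {γ} 0≤γ (c ∷ Ψ) = begin
  linearBound γ (fromℕ (numClauses 1 (c ∷ Ψ))) (fromℕ (numClauses 2 (c ∷ Ψ))) (agreement b (c ∷ Ψ))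
    ≡⟨ linearBound-cong (fromℕ-length-filter-∷ (λ c → arity c ℕ.≟ 1) c Ψ)
                        (fromℕ-length-filter-∷ (λ c → arity c ℕ.≟ 2) c Ψ) (agreement-∷ b c Ψ) ⟩
  linearBound γ (u₁ + m₁) (u₂ + m₂) (weight b c + agreement b Ψ)
    ≡⟨ linearBound-+ γ u₁ u₂ (weight b c) m₁ m₂ (agreement b Ψ) ⟩
  linearBound γ u₁ u₂ (weight b c) + linearBound γ m₁ m₂ (agreement b Ψ)
    ≤⟨ +-mono-≤ (linearBound≤satProb b 0≤γ c) (linearBound≤𝔼 b 0≤γ Ψ) ⟩
  satProb (coin b γ) c + 𝔼 (coin b γ) (fromℕ ∘ numSatisfied Ψ)
    ≡⟨ 𝔼-numSatisfied-∷ (coin b γ) c Ψ ⟨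
  𝔼 (coin b γ) (fromℕ ∘ numSatisfied (c ∷ Ψ)) ∎
  where
  open ≤-Reasoning
  u₁ u₂ m₁ m₂ : ℚ
  u₁ = 𝟙 (does (arity c ℕ.≟ 1))
  u₂ = 𝟙 (does (arity c ℕ.≟ 2))
  m₁ = fromℕ (numClauses 1 Ψ)
  m₂ = fromℕ (numClauses 2 Ψ)
  linearBound-cong : ∀ {x x′ y y′ w w′} → x ≡ x′ → y ≡ y′ → w ≡ w′ → linearBound γ x y w ≡ linearBound γ x′ y′ w′
  linearBound-cong refl refl refl = refl

-- The majority assignment and the bias.

isNonNegative : ℤ → Bool
isNonNegative (+ _)    = true
isNonNegative -[1+ _ ] = false

fromℕ-∣∣ : ∀ z → fromℕ ℤ.∣ z ∣ ≡ ⟦ isNonNegative z ⟧ * fromℤ z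
fromℕ-∣∣ (+ k)    = sym (*-identityˡ (fromℕ k))
fromℕ-∣∣ -[1+ k ] = solve 1 (λ x → x := con (- 1ℚ) :* (:- x)) refl (fromℕ (suc k))

-- Spelled exactly as inside `imbalance`, so that `imbalance` is its absolute value by definition.
signedImbalance : Max2OR n → Fin n → ℤ
signedImbalance Ψ i = + 2 ℤ.* + pos 1 i Ψ ℤ.+ + pos 2 i Ψ ℤ.- + 2 ℤ.* + neg 1 i Ψ ℤ.- + neg 2 i Ψ

fromℤ-signedImbalance : (Ψ : Max2OR n) (i : Fin n) → fromℤ (signedImbalance Ψ i) ≡ net Ψ i
fromℤ-signedImbalance Ψ i =
  trans (fromℤ-homo-minus (+ 2 ℤ.* P₁ ℤ.+ P₂ ℤ.- + 2 ℤ.* N₁) N₂) (cong (_- fromℤ N₂)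
    (trans (fromℤ-homo-minus (+ 2 ℤ.* P₁ ℤ.+ P₂) (+ 2 ℤ.* N₁)) (cong₂ _-_
      (trans (fromℤ-homo-+ (+ 2 ℤ.* P₁) P₂) (cong (_+ fromℤ P₂) (fromℤ-homo-* (+ 2) P₁)))
      (fromℤ-homo-* (+ 2) N₁))))
  where
  P₁ P₂ N₁ N₂ : ℤ
  P₁ = + pos 1 i Ψ
  P₂ = + pos 2 i Ψ
  N₁ = + neg 1 i Ψ
  N₂ = + neg 2 i Ψ

-- Ties go to true; a tied variable contributes 0 to `agreement` under either choice.
majority : Max2OR n → Assignment n
majority Ψ = Vec.tabulate (isNonNegative ∘ signedImbalance Ψ)

-- The majority sign turns each net count into its absolute value, so the agreement becomes the sum
-- of the imbalances.
½*agreement-majority : (Ψ : Max2OR n) → ½ * agreement (majority Ψ) Ψ ≡ bias Ψ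
½*agreement-majority {n} Ψ = cong (_*_ ½) (begin
  agreement (majority Ψ) Ψ
    ≡⟨ sum-cong-≗ (λ i → cong₂ (λ x y → ⟦ x ⟧ * y) (lookup∘tabulate (isNonNegative ∘ signedImbalance Ψ) i) (sym (fromℤ-signedImbalance Ψ i))) ⟩
  sum (λ i → ⟦ isNonNegative (signedImbalance Ψ i) ⟧ * fromℤ (signedImbalance Ψ i))
    ≡⟨ sum-cong-≗ (fromℕ-∣∣ ∘ signedImbalance Ψ) ⟨
  sum (fromℕ ∘ imbalance Ψ)
    ≡⟨ fromℕ-sum-tabulate (imbalance Ψ) ⟨
  fromℕ (sumℕ (tabulate (imbalance Ψ)))
    ≡⟨ cong (fromℕ ∘ sumℕ) (map-tabulate id (imbalance Ψ)) ⟨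
  fromℕ (sumℕ (map (imbalance Ψ) (allFin n))) ∎)
  where open ≡-Reasoning

-- A family of bounds indexed by γ; the range [0,1] makes each `coin` value a probability, as
-- `𝔼-upper` requires.
val-lower : (Ψ : Max2OR n) {γ : ℚ} → 0ℚ ≤ γ → γ ≤ 1ℚ →
  ½ * fromℕ (numClauses 1 Ψ) + (¾ - ¼ * (γ * γ)) * fromℕ (numClauses 2 Ψ) + ½ * γ * bias Ψ ≤ fromℕ (val Ψ)
val-lower Ψ {γ} 0≤γ γ≤1 = begin
  ½ * m₁ + (¾ - ¼ * (γ * γ)) * m₂ + ½ * γ * bias Ψ
    ≡⟨ cong (λ x → ½ * m₁ + (¾ - ¼ * (γ * γ)) * m₂ + ½ * γ * x) (½*agreement-majority Ψ) ⟨
  ½ * m₁ + (¾ - ¼ * (γ * γ)) * m₂ + ½ * γ * (½ * agreement b Ψ)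
    ≡⟨ cong (_+_ (½ * m₁ + (¾ - ¼ * (γ * γ)) * m₂))
         (solve 2 (λ γ w → con ½ :* γ :* (con ½ :* w) := con ¼ :* γ :* w) refl γ (agreement b Ψ)) ⟩
  linearBound γ m₁ m₂ (agreement b Ψ)
    ≤⟨ linearBound≤𝔼 b 0≤γ Ψ ⟩
  𝔼 (coin b γ) (fromℕ ∘ numSatisfied Ψ)
    ≤⟨ 𝔼-upper (coin b γ) (proj₁ ∘ ½*-bounds 0≤γ γ≤1 ∘ lookup b) (proj₂ ∘ ½*-bounds 0≤γ γ≤1 ∘ lookup b)
               (fromℕ-mono-≤ ∘ numSatisfied≤val Ψ) ⟩
  fromℕ (val Ψ) ∎
  where
  open ≤-Reasoning
  b = majority Ψ
  m₁ m₂ : ℚ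
  m₁ = fromℕ (numClauses 1 Ψ)
  m₂ = fromℕ (numClauses 2 Ψ)

-- Choosing γ.

0≤bias : (Ψ : Max2OR n) → 0ℚ ≤ bias Ψ
0≤bias {n} Ψ = *-monoˡ-≤-nonNeg ½ (fromℕ-mono-≤ {0} {sumℕ (map (imbalance Ψ) (allFin n))} ℕ.z≤n)

-- Uniqueness of inverses: both sides are inverse to the product of `m` and `n`.
1/[m*n] : ∀ m n .{{_ : ℕ.NonZero m}} .{{_ : ℕ.NonZero n}} .{{_ : ℕ.NonZero (m ℕ.* n)}} →
          + 1 / (m ℕ.* n) ≡ (+ 1 / m) * (+ 1 / n)
1/[m*n] m n = begin
  u                                       ≡⟨ *-identityʳ u ⟨
  u * 1ℚ                                  ≡⟨ cong₂ (λ x y → u * (x * y)) (fromℕ*1/ m) (fromℕ*1/ n) ⟨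
  u * ((M * v) * (N * w))                 ≡⟨ solve 5 (λ u M N v w → u :* ((M :* v) :* (N :* w)) := (M :* N) :* u :* (v :* w)) refl u M N v w ⟩
  (M * N) * u * (v * w)                   ≡⟨ cong (λ x → x * u * (v * w)) (fromℕ-homo-* m n) ⟨
  fromℕ (m ℕ.* n) * u * (v * w)           ≡⟨ cong (_* (v * w)) (fromℕ*1/ (m ℕ.* n)) ⟩
  1ℚ * (v * w)                            ≡⟨ *-identityˡ (v * w) ⟩
  v * w                                   ∎
  where
  open ≡-Reasoning
  u = + 1 / (m ℕ.* n)
  v = + 1 / m
  w = + 1 / n
  M = fromℕ m
  N = fromℕ n

lemma3p7 : ∀ {n : ℕ} (Ψ : Max2OR n) →
    let m₁ = numClauses 1 Ψ
        m₂ = numClauses 2 Ψ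
    in
    (fromℕ (val Ψ) ≥ (fromℕ m₁ + fromℕ m₂ + bias Ψ) ÷ℕ 2)
    ×
    ((m₂>0 : m₂ ℕ.> 0) → bias Ψ ≤ fromℕ m₂ →
      let instance
            m₂≢0 : ℕ.NonZero m₂
            m₂≢0 = ℕ.>-nonZero m₂>0
            4m₂≢0 : ℕ.NonZero (4 ℕ.* m₂)
            4m₂≢0 = m*n≢0 4 m₂
      in
      fromℕ (val Ψ) ≥
        fromℕ m₁ ÷ℕ 2 + fromℕ (3 ℕ.* m₂) ÷ℕ 4 + (bias Ψ * bias Ψ) ÷ℕ (4 ℕ.* m₂))
lemma3p7 Ψ = half ,
  λ m₂>0 → quadratic {{ℕ.>-nonZero m₂>0}} {{m*n≢0 4 (numClauses 2 Ψ) {{_}} {{ℕ.>-nonZero m₂>0}}}}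
  where
  open ≤-Reasoning
  k : ℕ
  k = numClauses 2 Ψ
  m₁ m₂ β v : ℚ
  m₁ = fromℕ (numClauses 1 Ψ)
  m₂ = fromℕ k
  β  = bias Ψ
  v  = fromℕ (val Ψ)

  half : (m₁ + m₂ + β) * ½ ≤ v
  half = begin
    (m₁ + m₂ + β) * ½
      -- At γ = 1 the coefficient of `m₂` is ¾ - ¼ = ½.
      ≡⟨ solve 3 (λ m₁ m₂ β → (m₁ :+ m₂ :+ β) :* con ½
           := con ½ :* m₁ :+ (con ¾ :- con ¼ :* (con 1ℚ :* con 1ℚ)) :* m₂ :+ con ½ :* con 1ℚ :* β) refl m₁ m₂ β ⟩
    ½ * m₁ + (¾ - ¼ * (1ℚ * 1ℚ)) * m₂ + ½ * 1ℚ * β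
      ≤⟨ val-lower Ψ (nonNegative⁻¹ 1ℚ) ≤-refl ⟩
    v ∎

  -- The choice γ = `β * r` = β/m₂ maximises ½γβ - ¼γ²m₂, with maximum β²/(4m₂); `β≤m₂` keeps it at
  -- most 1.
  quadratic : .{{_ : ℕ.NonZero k}} .{{_ : ℕ.NonZero (4 ℕ.* k)}} → β ≤ m₂ →
    m₁ * ½ + fromℕ (3 ℕ.* k) * ¼ + β * β * (+ 1 / (4 ℕ.* k)) ≤ v
  quadratic β≤m₂ = begin
    m₁ * ½ + fromℕ (3 ℕ.* k) * ¼ + β * β * (+ 1 / (4 ℕ.* k))
      ≡⟨ cong₂ (λ x y → m₁ * ½ + x * ¼ + β * β * y) (fromℕ-homo-* 3 k) (1/[m*n] 4 k) ⟩
    m₁ * ½ + fromℕ 3 * m₂ * ¼ + β * β * (¼ * r)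
      -- Here ¼β²r is split as ½β²r - ¼β²r. The trailing 1 is then replaced by `m₂ * r`, which turns
      -- the subtracted term into ¼γ²m₂.
      ≡⟨ solve 4 (λ m₁ m₂ β r → m₁ :* con ½ :+ con (fromℕ 3) :* m₂ :* con ¼ :+ β :* β :* (con ¼ :* r)
           := con ½ :* m₁ :+ con ¾ :* m₂ :+ con ½ :* (β :* r) :* β :- con ¼ :* (β :* β) :* r :* con 1ℚ) refl m₁ m₂ β r ⟩
    ½ * m₁ + ¾ * m₂ + ½ * (β * r) * β - ¼ * (β * β) * r * 1ℚ
      ≡⟨ cong (λ x → ½ * m₁ + ¾ * m₂ + ½ * (β * r) * β - ¼ * (β * β) * r * x) (fromℕ*1/ k) ⟨
    ½ * m₁ + ¾ * m₂ + ½ * (β * r) * β - ¼ * (β * β) * r * (m₂ * r)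
      ≡⟨ solve 4 (λ m₁ m₂ β r → con ½ :* m₁ :+ con ¾ :* m₂ :+ con ½ :* (β :* r) :* β :- con ¼ :* (β :* β) :* r :* (m₂ :* r)
           := con ½ :* m₁ :+ (con ¾ :- con ¼ :* ((β :* r) :* (β :* r))) :* m₂ :+ con ½ :* (β :* r) :* β) refl m₁ m₂ β r ⟩
    ½ * m₁ + (¾ - ¼ * ((β * r) * (β * r))) * m₂ + ½ * (β * r) * β
      ≤⟨ val-lower Ψ 0≤βr βr≤1 ⟩
    v ∎
    where
    r : ℚ
    r = + 1 / k
    r≥0 : NonNegative r
    r≥0 = normalize-nonNeg 1 k
    0≤βr : 0ℚ ≤ β * r
    0≤βr = nonNegative⁻¹ (β * r) {{nonNeg*nonNeg⇒nonNeg β {{nonNegative (0≤bias Ψ)}} r {{r≥0}}}}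
    βr≤1 : β * r ≤ 1ℚ
    βr≤1 = subst (β * r ≤_) (fromℕ*1/ k) (*-monoʳ-≤-nonNeg r {{r≥0}} β≤m₂)
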